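{- Every finite admissible-closed argumentation framework is naive-recasting.
   Context: All objects are finite. An argumentation framework is a pair $F=\langle \mathcal{A},\mathcal{R}\rangle$ where $\mathcal{A}$ is a finite set (of arguments) and $\mathcal{R}\subseteq\mathcal{A}\times\mathcal{A}$ (attacks; self-attacks are allowed). For $S\subseteq\mathcal{A}$: $S^+=\{x\in\mathcal{A}\mid \exists y\in S,\ (y,x)\in\mathcal{R}\}$ and $S^-=\{x\in\mathcal{A}\mid \exists y\in S,\ (x,y)\in\mathcal{R}\}$. A set $S\subseteq\mathcal{A}$ is conflict-free if $S\cap S^+=\emptyset$; naive sets are the inclusion-wise maximal conflict-free sets, forming the family $\mathrm{NAIV}(F)$. $S$ is admissible if it is conflict-free and self-defending, i.e. $S^-\subseteq S^+$. Preferred extensions are the inclusion-wise maximal admissible sets, forming the family $\mathrm{PREF}(F)$. $F$ is admissible-closed if its admissible sets are closed under intersection (the intersection of any two admissible sets is admissible). $F$ is naive-recasting if there exists an argumentation framework $F'=\langle\mathcal{A}',\mathcal{R}'\rangle$ such that $\mathrm{PREF}(F)=\mathrm{NAIV}(F')$. -}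

module Defs where

open import Level using (Level)
open import Data.List.Base using (List; filter; cartesianProduct)
open import Data.List.Membership.Propositional using (_∈_)
open import Data.List.Relation.Binary.Subset.Propositional using (_⊆_)
open import Data.Product.Base using (_×_; _,_; ∃-syntax)
open import Relation.Binary.Definitions using (DecidableEquality)
open import Relation.Unary using (Pred; _∩_; _≐_; Empty)
import Data.List.Membership.DecPropositional as DecMembership

private
  variable
    u : Level
    U : Set u

-- Arguments are drawn from an ambient type U, so that the extensions of two
-- different frameworks can be compared.  A finite subset of U is a list,
-- regarded only through its membership predicate: every notion below is
-- invariant under reordering and repetition.

record AF (U : Set u) : Set u where
  field
    𝓐     : List U
    𝓡     : List (U × U)
    𝓡⊆𝓐×𝓐 : 𝓡 ⊆ cartesianProduct 𝓐 𝓐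

open AF public

-- (y , x) ∈ 𝓡 F means that y attacks x.

[_]_⁺ : AF U → List U → Pred U _
[ F ] S ⁺ = λ x → x ∈ 𝓐 F × ∃[ y ] (y ∈ S × (y , x) ∈ 𝓡 F)

[_]_⁻ : AF U → List U → Pred U _
[ F ] S ⁻ = λ x → x ∈ 𝓐 F × ∃[ y ] (y ∈ S × (x , y) ∈ 𝓡 F)

record ConflictFree {U : Set u} (F : AF U) (S : List U) : Set u where
  field
    S⊆𝓐    : S ⊆ 𝓐 F
    S∩S⁺≡∅ : Empty ((_∈ S) ∩ ([ F ] S ⁺))

record Admissible {U : Set u} (F : AF U) (S : List U) : Set u where
  field
    conflictFree  : ConflictFree F S
    selfDefending : ∀ {x} → ([ F ] S ⁻) x → ([ F ] S ⁺) x

-- T ⊆ S together with S ⊆ T says that S and T are the same set.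

record Maximal {U : Set u} (P : Pred (List U) u) (S : List U) : Set u where
  field
    holds   : P S
    maximal : ∀ T → P T → S ⊆ T → T ⊆ S

NAIV : AF U → Pred (List U) _
NAIV F = Maximal (ConflictFree F)

PREF : AF U → Pred (List U) _
PREF F = Maximal (Admissible F)

module _ {U : Set u} (_≟_ : DecidableEquality U) where

  open DecMembership _≟_ using (_∈?_)

  intersection : List U → List U → List U
  intersection S T = filter (_∈? T) S

  AdmissibleClosed : AF U → Set u
  AdmissibleClosed F =
    ∀ S T → Admissible F S → Admissible F T → Admissible F (intersection S T)

NaiveRecasting : {U : Set u} → AF U → Set u
NaiveRecasting {U = U} F = ∃[ F′ ] PREF {U = U} F ≐ NAIV F′

{-# OPTIONS --safe #-}

-- Let x be a credulously accepted argument, that is, one lying in some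
-- admissible set.  By intersection-closure there is a least admissible set
-- core x containing x.  Let F′ have the credulously accepted arguments, two of
-- them attacking each other when no admissible set contains both.  Admissible
-- sets are conflict-free in F′.  Conversely, if S is conflict-free in F′, then
-- the union of the cores of its members is admissible: it defends itself as a
-- union of admissible sets, and an attack from core y to core z would lie inside
-- any admissible set containing y and z.  So the admissible sets of F and the
-- conflict-free sets of F′ are cofinal in each other and have the same maximal
-- elements.

module Submission where

open import Defs
open import Level using (Level)
open import Data.Bool.Base using (true; false)
open import Data.List.Base
  using (List; []; _∷_; _++_; map; filter; foldr; concatMap; cartesianProduct)
open import Data.List.Membership.Propositional using (_∈_; find; lose)
open import Data.List.Membership.Propositional.Properties
  using (∈-filter⁺; ∈-filter⁻; ∈-++⁺ˡ; ∈-++⁺ʳ; ∈-map⁺; ∈-cartesianProduct⁺;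
         ∈-cartesianProduct⁻; ∈-concatMap⁺; ∈-concatMap⁻)
open import Data.List.Relation.Binary.Subset.Propositional using (_⊆_)
open import Data.List.Relation.Unary.All as All using (All; []; _∷_; all?)
open import Data.List.Relation.Unary.Any using (Any; here; there; any?)
open import Data.Product.Base
  using (_×_; _,_; proj₁; proj₂; ∃-syntax; uncurry)
open import Data.Product.Properties using (≡-dec)
open import Function.Base using (_∘_)
open import Relation.Binary.Definitions using (DecidableEquality)
open import Relation.Binary.PropositionalEquality using (refl)
open import Relation.Nullary using (¬_; Dec; does)
open import Relation.Nullary.Decidable
  using (map′; _×-dec_; _→-dec_; ¬?; decidable-stable)
open import Relation.Unary using (Pred; Decidable; _≐_)
import Data.List.Membership.DecPropositional as DecMembership

private
  variable
    p u : Level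
    U : Set u

-- A maximal `Q`-set lies inside some `P`-set, which is again a `Q`-set and so has the same members;
-- `resp` transports `P` back along this equality of membership. Conversely, a `Q`-set above a
-- maximal `P`-set extends to a `P`-set, which maximality collapses.
maximal-cofinal : {P Q : Pred (List U) _} →
  (∀ {S T} → S ⊆ T → T ⊆ S → P S → P T) →
  (∀ {S} → P S → Q S) →
  (∀ {S} → Q S → ∃[ T ] (P T × S ⊆ T)) →
  Maximal P ≐ Maximal Q
maximal-cofinal {P = P} {Q} resp P⇒Q extend = to , from
  where
  to : ∀ {S} → Maximal P S → Maximal Q S
  to max = record
    { holds   = P⇒Q (Maximal.holds max)
    ; maximal = λ T QT S⊆T →
        let T′ , PT′ , T⊆T′ = extend QT
        in Maximal.maximal max T′ PT′ (T⊆T′ ∘ S⊆T) ∘ T⊆T′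
    }

  from : ∀ {S} → Maximal Q S → Maximal P S
  from max =
    let T , PT , S⊆T = extend (Maximal.holds max)
    in record
      { holds   = resp (Maximal.maximal max T (P⇒Q PT) S⊆T) S⊆T PT
      ; maximal = λ T PT → Maximal.maximal max T (P⇒Q PT)
      }

sublists : List U → List (List U)
sublists []       = [] ∷ []
sublists (x ∷ xs) = map (x ∷_) (sublists xs) ++ sublists xs

-- Lets `sublists xs` serve as a finite power set: a subset of `xs` with decidable membership has
-- the same members as a filter of `xs`.
filter-∈-sublists : {P : Pred U p} (P? : Decidable P) (xs : List U) →
  filter P? xs ∈ sublists xs
filter-∈-sublists P? []       = here refl
filter-∈-sublists P? (x ∷ xs) with does (P? x)
... | true  = ∈-++⁺ˡ (∈-map⁺ (x ∷_) (filter-∈-sublists P? xs))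
... | false = ∈-++⁺ʳ (map (x ∷_) (sublists xs)) (filter-∈-sublists P? xs)

module _ {U : Set u} (F : AF U) where

  attacker∈𝓐 : ∀ {x y} → (x , y) ∈ 𝓡 F → x ∈ 𝓐 F
  attacker∈𝓐 = proj₁ ∘ ∈-cartesianProduct⁻ (𝓐 F) (𝓐 F) ∘ 𝓡⊆𝓐×𝓐 F

  -- This and `Defending` drop the side conditions of membership in `𝓐 F`, which are recovered from
  -- `S ⊆ 𝓐 F` and from `𝓡⊆𝓐×𝓐`.
  Unattacking : Pred (List U) u
  Unattacking S = ∀ {x y} → x ∈ S → y ∈ S → ¬ (x , y) ∈ 𝓡 F

  Defending : Pred (List U) u
  Defending S = ∀ {x y} → (x , y) ∈ 𝓡 F → y ∈ S → ∃[ z ] (z ∈ S × (z , x) ∈ 𝓡 F)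

  conflictFree⁺ : ∀ {S} → S ⊆ 𝓐 F → Unattacking S → ConflictFree F S
  conflictFree⁺ S⊆𝓐 unatt = record
    { S⊆𝓐    = S⊆𝓐
    ; S∩S⁺≡∅ = λ { _ (x∈S , _ , _ , y∈S , y→x) → unatt y∈S x∈S y→x }
    }

  unattacking : ∀ {S} → ConflictFree F S → Unattacking S
  unattacking cf x∈S y∈S x→y =
    ConflictFree.S∩S⁺≡∅ cf _ (y∈S , ConflictFree.S⊆𝓐 cf y∈S , _ , x∈S , x→y)

  admissible⁺ : ∀ {S} → S ⊆ 𝓐 F → Unattacking S → Defending S → Admissible F S
  admissible⁺ S⊆𝓐 unatt defends = record
    { conflictFree  = conflictFree⁺ S⊆𝓐 unatt
    ; selfDefending = λ { (x∈𝓐 , _ , y∈S , x→y) → x∈𝓐 , defends x→y y∈S }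
    }

  admissible⇒⊆𝓐 : ∀ {S} → Admissible F S → S ⊆ 𝓐 F
  admissible⇒⊆𝓐 = ConflictFree.S⊆𝓐 ∘ Admissible.conflictFree

  admissible⇒unattacking : ∀ {S} → Admissible F S → Unattacking S
  admissible⇒unattacking = unattacking ∘ Admissible.conflictFree

  admissible⇒defending : ∀ {S} → Admissible F S → Defending S
  admissible⇒defending adm x→y y∈S =
    proj₂ (Admissible.selfDefending adm (attacker∈𝓐 x→y , _ , y∈S , x→y))

  admissible-resp : ∀ {S T} → S ⊆ T → T ⊆ S → Admissible F S → Admissible F T
  admissible-resp S⊆T T⊆S adm = admissible⁺
    (admissible⇒⊆𝓐 adm ∘ T⊆S)
    (λ x∈T y∈T → admissible⇒unattacking adm (T⊆S x∈T) (T⊆S y∈T))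
    (λ x→y y∈T →
      let z , z∈S , z→x = admissible⇒defending adm x→y (T⊆S y∈T)
      in z , S⊆T z∈S , z→x)

module _ {U : Set u} (_≟_ : DecidableEquality U) where

  open DecMembership _≟_ using (_∈?_)
  open DecMembership (≡-dec _≟_ _≟_) using () renaming (_∈?_ to _∈ₚ?_)

  intersection⁺ : ∀ {S T x} → x ∈ S → x ∈ T → x ∈ intersection _≟_ S T
  intersection⁺ {T = T} = ∈-filter⁺ (_∈? T)

  intersection⁻ : ∀ {S T x} → x ∈ intersection _≟_ S T → x ∈ S × x ∈ T
  intersection⁻ {T = T} = ∈-filter⁻ (_∈? T)

  ⋂[_]_ : List U → List (List U) → List U
  ⋂[ X ] Ss = foldr (intersection _≟_) X Ss

  ⋂⁺ : ∀ {X x} Ss → x ∈ X → All (x ∈_) Ss → x ∈ ⋂[ X ] Ss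
  ⋂⁺ []       x∈X []           = x∈X
  ⋂⁺ (S ∷ Ss) x∈X (x∈S ∷ x∈Ss) = intersection⁺ x∈S (⋂⁺ Ss x∈X x∈Ss)

  ⋂⊆ : ∀ {X S Ss} → S ∈ Ss → ⋂[ X ] Ss ⊆ S
  ⋂⊆ {Ss = S ∷ Ss} (here refl)  = proj₁ ∘ intersection⁻ {S}
  ⋂⊆ {Ss = S ∷ Ss} (there S∈Ss) = ⋂⊆ S∈Ss ∘ proj₂ ∘ intersection⁻ {S}

  module _ (F : AF U) where

    unattacking? : Decidable (Unattacking F)
    unattacking? S = map′
      (λ h x∈S y∈S → All.lookup (All.lookup h x∈S) y∈S)
      (λ h → All.tabulate λ x∈S → All.tabulate λ y∈S → h x∈S y∈S)
      (all? (λ x → all? (λ y → ¬? ((x , y) ∈ₚ? 𝓡 F)) S) S)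

    defending? : Decidable (Defending F)
    defending? S = map′
      (λ h x→y y∈S → find (All.lookup h x→y y∈S))
      (λ h → All.tabulate λ x→y y∈S → let _ , z∈S , z→x = h x→y y∈S in lose z∈S z→x)
      -- Ranging over attack pairs instead of arguments of `U` makes the search finite.
      (all? (λ (x , y) → y ∈? S →-dec any? (λ z → (z , x) ∈ₚ? 𝓡 F) S) (𝓡 F))

    admissible? : Decidable (Admissible F)
    admissible? S = map′ to from
      (all? (_∈? 𝓐 F) S ×-dec unattacking? S ×-dec defending? S)
      where
      to : All (_∈ 𝓐 F) S × Unattacking F S × Defending F S → Admissible F S
      to (S⊆𝓐 , unatt , defends) = admissible⁺ F (All.lookup S⊆𝓐) unatt defends

      from : Admissible F S → All (_∈ 𝓐 F) S × Unattacking F S × Defending F S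
      from adm = All.tabulate (admissible⇒⊆𝓐 F adm)
               , admissible⇒unattacking F adm , admissible⇒defending F adm

    admissibles : List (List U)
    admissibles = filter admissible? (sublists (𝓐 F))

    admissibles-sound : ∀ {S} → S ∈ admissibles → Admissible F S
    admissibles-sound = proj₂ ∘ ∈-filter⁻ admissible? {xs = sublists (𝓐 F)}

    -- `S` may repeat or reorder arguments and so be absent from `admissibles`; filtering `𝓐 F` by
    -- membership in `S` gives a listed representative.
    admissibles-complete : ∀ {S} → Admissible F S →
      ∃[ T ] (T ∈ admissibles × S ⊆ T)
    admissibles-complete {S} adm =
      intersection _≟_ (𝓐 F) S ,
      ∈-filter⁺ admissible? (filter-∈-sublists (_∈? S) (𝓐 F))
        (admissible-resp F S⊆ (proj₂ ∘ intersection⁻ {𝓐 F}) adm) ,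
      S⊆
      where
      S⊆ : S ⊆ intersection _≟_ (𝓐 F) S
      S⊆ x∈S = intersection⁺ (admissible⇒⊆𝓐 F adm x∈S) x∈S

    -- Searching the finite list `admissibles` keeps the relation decidable. Its diagonal is
    -- credulous acceptance.
    CoAccepted : U → U → Set u
    CoAccepted x y = Any (λ S → x ∈ S × y ∈ S) admissibles

    coAccepted? : ∀ x y → Dec (CoAccepted x y)
    coAccepted? x y = any? (λ S → x ∈? S ×-dec y ∈? S) admissibles

    admissible⇒coAccepted : ∀ {S x y} → Admissible F S → x ∈ S → y ∈ S →
      CoAccepted x y
    admissible⇒coAccepted adm x∈S y∈S =
      let _ , T∈ , S⊆T = admissibles-complete adm in lose T∈ (S⊆T x∈S , S⊆T y∈S)

    recast : AF U
    recast = record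
      { 𝓐     = 𝓐′
      ; 𝓡     = filter (¬? ∘ uncurry coAccepted?) (cartesianProduct 𝓐′ 𝓐′)
      ; 𝓡⊆𝓐×𝓐 = proj₁ ∘ ∈-filter⁻ (¬? ∘ uncurry coAccepted?)
      }
      where
      𝓐′ : List U
      𝓐′ = filter (λ x → coAccepted? x x) (𝓐 F)

    admissible⇒conflictFree : ∀ {S} → Admissible F S → ConflictFree recast S
    admissible⇒conflictFree adm = conflictFree⁺ recast
      (λ x∈S → ∈-filter⁺ (λ x → coAccepted? x x)
                 (admissible⇒⊆𝓐 F adm x∈S) (admissible⇒coAccepted adm x∈S x∈S))
      (λ x∈S y∈S x→y →
        proj₂ (∈-filter⁻ (¬? ∘ uncurry coAccepted?)
                 {xs = cartesianProduct (𝓐 recast) (𝓐 recast)} x→y)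
              (admissible⇒coAccepted adm x∈S y∈S))

    conflictFree⇒coAccepted : ∀ {S x y} → ConflictFree recast S →
      x ∈ S → y ∈ S → CoAccepted x y
    conflictFree⇒coAccepted {x = x} {y} cf x∈S y∈S =
      -- Attacks in `recast` record failures of co-acceptance, so their absence yields only a double
      -- negation.
      decidable-stable (coAccepted? x y) λ ¬co →
        unattacking recast cf x∈S y∈S
          (∈-filter⁺ (¬? ∘ uncurry coAccepted?)
            (∈-cartesianProduct⁺ (S⊆𝓐 x∈S) (S⊆𝓐 y∈S)) ¬co)
      where open ConflictFree cf

    -- The seed `𝓐 F` contains every admissible set, so it affects the result only when no
    -- admissible set contains `x`.
    core : U → List U
    core x = ⋂[ 𝓐 F ] filter (x ∈?_) admissibles

    core⊆ : ∀ {x S} → S ∈ admissibles → x ∈ S → core x ⊆ S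
    core⊆ {x} S∈ x∈S = ⋂⊆ (∈-filter⁺ (x ∈?_) S∈ x∈S)

    ∈-core : ∀ {x} → x ∈ 𝓐 F → x ∈ core x
    ∈-core {x} x∈𝓐 = ⋂⁺ (filter (x ∈?_) admissibles) x∈𝓐
      (All.tabulate (proj₂ ∘ ∈-filter⁻ (x ∈?_) {xs = admissibles}))

    module _ (closed : AdmissibleClosed _≟_ F) where

      -- The empty intersection is 𝓐 F, which need not be admissible.
      ⋂-admissible : ∀ {S Ss} → S ∈ Ss → All (Admissible F) Ss →
        Admissible F (⋂[ 𝓐 F ] Ss)
      ⋂-admissible {Ss = S ∷ []} _ (adm ∷ []) = admissible-resp F
        (λ x∈S → intersection⁺ x∈S (admissible⇒⊆𝓐 F adm x∈S))
        (proj₁ ∘ intersection⁻ {S}) adm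
      ⋂-admissible {Ss = _ ∷ _ ∷ _} _ (adm ∷ adms) =
        closed _ _ adm (⋂-admissible (here refl) adms)

      -- Credulous acceptance makes the intersected family nonempty, so closure under binary
      -- intersection applies.
      core-admissible : ∀ {x} → CoAccepted x x → Admissible F (core x)
      core-admissible {x} co =
        let _ , S∈ , x∈S , _ = find co
        in ⋂-admissible (∈-filter⁺ (x ∈?_) S∈ x∈S)
             (All.tabulate (admissibles-sound ∘ proj₁ ∘ ∈-filter⁻ (x ∈?_)))

      conflictFree⇒⊆admissible : ∀ {S} → ConflictFree recast S →
        ∃[ T ] (Admissible F T × S ⊆ T)
      conflictFree⇒⊆admissible {S} cf =
        T , admissible⁺ F T⊆𝓐 unatt defends , λ x∈S → ∈-T x∈S (∈-core (S⊆𝓐F x∈S))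
        where
        T : List U
        T = concatMap core S

        S⊆𝓐F : S ⊆ 𝓐 F
        S⊆𝓐F = proj₁ ∘ ∈-filter⁻ (λ x → coAccepted? x x) ∘ ConflictFree.S⊆𝓐 cf

        core-adm : ∀ {x} → x ∈ S → Admissible F (core x)
        core-adm x∈S = core-admissible (conflictFree⇒coAccepted cf x∈S x∈S)

        ∈-T : ∀ {a x} → x ∈ S → a ∈ core x → a ∈ T
        ∈-T x∈S a∈ = ∈-concatMap⁺ core (lose x∈S a∈)

        T-∈ : ∀ {a} → a ∈ T → ∃[ x ] (x ∈ S × a ∈ core x)
        T-∈ = find ∘ ∈-concatMap⁻ core

        T⊆𝓐 : T ⊆ 𝓐 F
        T⊆𝓐 a∈T = let _ , x∈S , a∈ = T-∈ a∈T in admissible⇒⊆𝓐 F (core-adm x∈S) a∈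

        unatt : Unattacking F T
        unatt a∈T b∈T =
          let _ , x∈S , a∈ = T-∈ a∈T
              _ , y∈S , b∈ = T-∈ b∈T
              -- A single admissible set contains both generators, hence both cores by minimality,
              -- and it is conflict-free.
              _ , E∈ , x∈E , y∈E = find (conflictFree⇒coAccepted cf x∈S y∈S)
          in admissible⇒unattacking F (admissibles-sound E∈)
               (core⊆ E∈ x∈E a∈) (core⊆ E∈ y∈E b∈)

        defends : Defending F T
        defends a→b b∈T =
          let _ , x∈S , b∈ = T-∈ b∈T
              c , c∈ , c→a = admissible⇒defending F (core-adm x∈S) a→b b∈
          in c , ∈-T x∈S c∈ , c→a

theorem4p1 : ∀ {u : Level} {U : Set u} (_≟_ : DecidableEquality U) (F : AF U) →
    AdmissibleClosed _≟_ F → NaiveRecasting F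
theorem4p1 _≟_ F closed = recast _≟_ F , maximal-cofinal
  (admissible-resp F) (admissible⇒conflictFree _≟_ F)
  (conflictFree⇒⊆admissible _≟_ F closed)
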